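{- Let $k$ be a positive integer, let $\mathcal{C}=(c_1,\dots,c_k)$ be a $k$-tuple of positive integers with $c_i\le c_{i+1}$, and put $\mathbf{h}=c_1+\cdots+c_k$. For every positive integer $n$, $$\delta_k(\mathcal{C};n)=q_k(\mathcal{C};8n+\mathbf{h}).$$ That is, the number of representations of $n$ by $\sum_{i=1}^k c_i\frac{z_i(z_i+1)}{2}$ equals the number of representations of $8n+\mathbf{h}$ as a sum of $k$ odd integer squares with coefficients $c_i$. In particular, when all $c_i=1$, $\delta_k(n)=q_k(8n+k)$.
   Context: $\delta_k(\mathcal{C};n)=\#\{(z_1,\dots,z_k)\in\mathbb{Z}_{\ge 0}^k: n=\sum_{i=1}^k c_i\frac{z_i(z_i+1)}{2}\}$ and $q_k(\mathcal{C};n)=\#\{(y_1,\dots,y_k)\in\mathbb{Z}^k: n=\sum_{i=1}^k c_iy_i^2,\ y_i\ge 0,\ 2\nmid y_i\}$. When all $c_i=1$ these are written $\delta_k(n)$ and $q_k(n)$. -}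

module Defs where

open import Data.Integer.Base as ℤ using (ℤ; +_; 0ℤ; +≤+)
import Data.Integer.Divisibility.Signed as ℤ
import Data.Integer.Properties as ℤ
open import Data.List.Base as List using (List; []; _∷_)
open import Data.List.Membership.Propositional using (_∈_)
open import Data.List.Membership.Propositional.Properties
  using (∈-filter⁺; ∈-filter⁻; ∈-map⁺; ∈-upTo⁺; ∈-cartesianProductWith⁺)
open import Data.List.Relation.Unary.Any using (here)
open import Data.List.Relation.Unary.Unique.Propositional using (Unique)
import Data.List.Relation.Unary.Unique.Propositional.Properties as Unique
open import Data.List.Relation.Unary.All as ListAll using ()
open import Data.List.Relation.Unary.AllPairs as ListAllPairs using ()
open import Data.Nat.Base using (ℕ; zero; suc; _+_; _*_; _≤_; _<_; s≤s; z≤n; >-nonZero)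
open import Data.Nat.DivMod using (_/_; m*n/n≡m; /-monoˡ-≤)
import Data.Nat.Properties as ℕ
open import Data.Product.Base using (_×_; _,_; proj₂)
open import Data.Vec.Base as Vec using (Vec; []; _∷_; zipWith; replicate)
import Data.Vec.Properties as Vec
open import Data.Vec.Relation.Unary.All as All using (All; []; _∷_)
open import Function.Bundles using (_⇔_; mk⇔)
open import Relation.Binary.PropositionalEquality using (_≡_; refl; sym; trans; subst)
open import Relation.Nullary.Decidable using (_×-dec_; ¬?)
open import Relation.Nullary.Negation using (¬_)
open import Relation.Unary using (Pred; Decidable)

record Finite {A : Set} (P : Pred A _) : Set where
  field
    elements   : List A
    unique     : Unique elements
    enumerates : ∀ x → x ∈ elements ⇔ P x

-- Any two witnesses of finiteness for the same P give the same number.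

# : {A : Set} {P : Pred A _} → Finite P → ℕ
# fin = List.length (Finite.elements fin)

sumℤ : ∀ {k} → Vec ℤ k → ℤ
sumℤ = Vec.foldr′ ℤ._+_ 0ℤ

-- z * (z + 1) is even, so the truncating division is exact.

triangular : ℕ → ℕ
triangular z = (z * (z + 1)) / 2

triangularSum : ∀ {k} → Vec ℕ k → Vec ℕ k → ℕ
triangularSum C z = Vec.sum (zipWith (λ cᵢ zᵢ → cᵢ * triangular zᵢ) C z)

squareSum : ∀ {k} → Vec ℕ k → Vec ℤ k → ℤ
squareSum C y = sumℤ (zipWith (λ cᵢ yᵢ → + cᵢ ℤ.* (yᵢ ℤ.^ 2)) C y)

TriangularRep : ∀ {k} → Vec ℕ k → ℕ → Pred (Vec ℕ k) _
TriangularRep C n z = n ≡ triangularSum C z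

OddSquareRep : ∀ {k} → Vec ℕ k → ℕ → Pred (Vec ℤ k) _
OddSquareRep C n y =
  + n ≡ squareSum C y × All (0ℤ ℤ.≤_) y × All (λ yᵢ → ¬ (+ 2 ℤ.∣ yᵢ)) y

Positive : ∀ {k} → Vec ℕ k → Set
Positive = All (0 <_)

-- Every coordinate of a solution is at most n, so filtering a box finds them all.

private

  box : {A : Set} → List A → ∀ k → List (Vec A k)
  box xs zero    = [] ∷ []
  box xs (suc k) = List.cartesianProductWith _∷_ xs (box xs k)

  box-unique : {A : Set} {xs : List A} → Unique xs → ∀ k → Unique (box xs k)
  box-unique u zero    = ListAll.[] ListAllPairs.∷ ListAllPairs.[]
  box-unique u (suc k) =
    Unique.cartesianProductWith⁺ _∷_ Vec.∷-injective u (box-unique u k)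

  ∈-box : {A : Set} {xs : List A} → ∀ {k} {v : Vec A k} → All (_∈ xs) v → v ∈ box xs k
  ∈-box []       = here refl
  ∈-box (p ∷ ps) = ∈-cartesianProductWith⁺ _∷_ p (∈-box ps)

  finite : {A : Set} {k : ℕ} {P : Pred (Vec A k) _} → Decidable P →
           (xs : List A) → Unique xs → (∀ {v} → P v → All (_∈ xs) v) → Finite P
  finite {k = k} P? xs u bounded = record
    { elements   = List.filter P? (box xs k)
    ; unique     = Unique.filter⁺ P? (box-unique u k)
    ; enumerates = λ v → mk⇔ (λ v∈ → proj₂ (∈-filter⁻ P? {xs = box xs k} v∈))
                             (λ p → ∈-filter⁺ P? (∈-box (bounded p)) p)
    }

  m≤c*m : ∀ {c} m → 0 < c → m ≤ c * m
  m≤c*m {c} m 0<c = ℕ.m≤n*m m c ⦃ >-nonZero 0<c ⦄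

  m≤m*m : ∀ m → m ≤ m * m
  m≤m*m zero      = z≤n
  m≤m*m m@(suc _) = ℕ.m≤m*n m m

  z≤triangular : ∀ z → z ≤ triangular z
  z≤triangular zero      = z≤n
  z≤triangular z@(suc m) = subst (_≤ triangular z) (m*n/n≡m z 2)
    (/-monoˡ-≤ 2 (ℕ.*-monoʳ-≤ z (s≤s (subst (1 ≤_) (ℕ.+-comm 1 m) (s≤s z≤n)))))

  triangular-bound : ∀ {k} {C : Vec ℕ k} → Positive C → ∀ z →
                     All (_≤ triangularSum C z) z
  triangular-bound []        []       = []
  triangular-bound (0<c ∷ p) (z ∷ zs) =
    ℕ.≤-trans (ℕ.≤-trans (z≤triangular z) (m≤c*m _ 0<c)) (ℕ.m≤m+n _ _) ∷
    All.map (λ le → ℕ.≤-trans le (ℕ.m≤n+m _ _)) (triangular-bound p zs)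

  squareSumℕ : ∀ {k} → Vec ℕ k → Vec ℕ k → ℕ
  squareSumℕ C y = Vec.sum (zipWith (λ c x → c * (x * x)) C y)

  +-square : ∀ c x → + c ℤ.* ((+ x) ℤ.^ 2) ≡ + (c * (x * x))
  +-square c x
    rewrite ℤ.*-identityʳ (+ x)
          | sym (ℤ.pos-* x x)
          | sym (ℤ.pos-* c (x * x)) = refl

  squareSum-map : ∀ {k} (C y : Vec ℕ k) → squareSum C (Vec.map +_ y) ≡ + squareSumℕ C y
  squareSum-map []      []      = refl
  squareSum-map (c ∷ C) (x ∷ y)
    rewrite +-square c x | squareSum-map C y = refl

  square-bound : ∀ {k} {C : Vec ℕ k} → Positive C → ∀ y → All (_≤ squareSumℕ C y) y
  square-bound []        []       = []
  square-bound (0<c ∷ p) (x ∷ y) =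
    ℕ.≤-trans (ℕ.≤-trans (m≤m*m x) (m≤c*m _ 0<c)) (ℕ.m≤m+n _ _) ∷
    All.map (λ le → ℕ.≤-trans le (ℕ.m≤n+m _ _)) (square-bound p y)

  data Nonneg : ∀ {k} → Vec ℤ k → Set where
    nonneg : ∀ {k} (y : Vec ℕ k) → Nonneg (Vec.map +_ y)

  toNonneg : ∀ {k} {y : Vec ℤ k} → All (0ℤ ℤ.≤_) y → Nonneg y
  toNonneg [] = nonneg []
  toNonneg (+≤+ {n = m} _ ∷ ps) with toNonneg ps
  ... | nonneg y = nonneg (m ∷ y)

  all-map : ∀ {k} {xs : List ℕ} {y : Vec ℕ k} →
            All (_∈ xs) y → All (_∈ List.map +_ xs) (Vec.map +_ y)
  all-map []       = []
  all-map (p ∷ ps) = ∈-map⁺ +_ p ∷ all-map ps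

  oddSquareRep-bounded : ∀ {k} {C : Vec ℕ k} → Positive C → ∀ n {y} → OddSquareRep C n y →
                         All (_∈ List.map +_ (List.upTo (suc n))) y
  oddSquareRep-bounded {C = C} pos n (eq , y≥0 , _) with toNonneg y≥0
  ... | nonneg x with refl ← ℤ.+-injective (trans eq (squareSum-map C x)) =
    all-map (All.map (λ le → ∈-upTo⁺ (s≤s le)) (square-bound pos x))

triangularRep-finite : ∀ {k} (C : Vec ℕ k) → Positive C → ∀ n → Finite (TriangularRep C n)
triangularRep-finite C pos n = finite (λ z → n ℕ.≟ triangularSum C z)
  (List.upTo (suc n)) (Unique.upTo⁺ (suc n))
  (λ { {z} refl → All.map (λ le → ∈-upTo⁺ (s≤s le)) (triangular-bound pos z) })

oddSquareRep-finite : ∀ {k} (C : Vec ℕ k) → Positive C → ∀ n → Finite (OddSquareRep C n)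
oddSquareRep-finite C pos n = finite
  (λ y → (+ n ℤ.≟ squareSum C y) ×-dec
         All.all? (0ℤ ℤ.≤?_) y ×-dec All.all? (λ yᵢ → ¬? (+ 2 ℤ.∣? yᵢ)) y)
  (List.map +_ (List.upTo (suc n)))
  (Unique.map⁺ ℤ.+-injective (Unique.upTo⁺ (suc n)))
  (oddSquareRep-bounded pos n)

δ : ∀ {k} (C : Vec ℕ k) → Positive C → ℕ → ℕ
δ C pos n = # (triangularRep-finite C pos n)

q : ∀ {k} (C : Vec ℕ k) → Positive C → ℕ → ℕ
q C pos n = # (oddSquareRep-finite C pos n)

ones : ∀ k → Vec ℕ k
ones k = replicate k 1

ones-positive : ∀ k → Positive (ones k)
ones-positive zero    = []
ones-positive (suc k) = s≤s z≤n ∷ ones-positive k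

δ₁ : (k n : ℕ) → ℕ
δ₁ k n = δ (ones k) (ones-positive k) n

q₁ : (k n : ℕ) → ℕ
q₁ k n = q (ones k) (ones-positive k) n

{-# OPTIONS --safe #-}

-- The map zᵢ ↦ 2zᵢ + 1 is a bijection from ℕ onto the odd nonnegative integers,
-- and (2z + 1)² = 8 · z(z + 1)/2 + 1, so applied coordinatewise it carries the
-- representations of n onto those of 8n + h.

module Submission where

open import Defs
open import Data.Integer.Base as ℤ using (ℤ; +_; 0ℤ; +≤+)
import Data.Integer.Divisibility.Signed as ℤ
import Data.Integer.Properties as ℤ
open import Data.List.Base as List using ()
open import Data.List.Membership.Propositional using (_∈_)
open import Data.List.Membership.Propositional.Properties using (∈-map⁺; ∈-map⁻)
open import Data.List.Membership.Propositional.Properties.WithK using (unique∧set⇒bag)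
open import Data.List.Properties using (length-map)
open import Data.List.Relation.Binary.BagAndSetEquality using (∼bag⇒↭)
open import Data.List.Relation.Binary.Permutation.Propositional.Properties using (↭-length)
import Data.List.Relation.Unary.Unique.Propositional.Properties as Unique
open import Data.Nat.Base using (ℕ; zero; suc; _+_; _*_; _≤_; _<_; z≤n; s≤s)
open import Data.Nat.Divisibility using (_∣_; divides; divides-refl; ∣m∣n⇒∣m+n; n∣m*n)
open import Data.Nat.DivMod using (_%_; _/_; m%n<n; m≡m%n+[m/n]*n; m/n*n≡m)
import Data.Nat.Properties as ℕ
open import Data.Nat.Tactic.RingSolver using (solve-∀)
open import Data.Product.Base using (_×_; _,_; ∃)
open import Data.Vec.Base as Vec using (Vec; []; _∷_; sum)
open import Data.Vec.Properties using (∷-injective)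
open import Data.Vec.Relation.Unary.All as All using (All; []; _∷_)
import Data.Vec.Relation.Unary.All.Properties as All
open import Data.Vec.Relation.Unary.Linked using (Linked)
open import Function.Base using (_∘_)
open import Function.Bundles using (mk⇔; Equivalence)
open import Function.Definitions using (Injective)
open import Relation.Binary.PropositionalEquality
  using (_≡_; refl; sym; trans; cong; cong₂; subst; module ≡-Reasoning)
open import Relation.Nullary.Negation using (¬_; contradiction)
open import Relation.Unary using (Pred)

open ≡-Reasoning

-- Injectivity keeps the image list under `f` free of repetitions, while `sound` and `complete` give
-- it the same members as the list for `Q`. Two such lists are permutations of each other, hence
-- equally long. Surjectivity is asked only onto `Q`, with preimages in `P`.
#-bijection : {A B : Set} {P : Pred A _} {Q : Pred B _}
              (finP : Finite P) (finQ : Finite Q) (f : A → B) →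
              Injective _≡_ _≡_ f → (∀ {x} → P x → Q (f x)) →
              (∀ {y} → Q y → ∃ λ x → P x × y ≡ f x) →
              # finP ≡ # finQ
#-bijection finP finQ f inj sound complete = begin
  List.length P.elements              ≡⟨ length-map f P.elements ⟨
  List.length (List.map f P.elements) ≡⟨ ↭-length (∼bag⇒↭ (unique∧set⇒bag
                                           (Unique.map⁺ inj P.unique) Q.unique
                                           (mk⇔ to from))) ⟩
  List.length Q.elements              ∎
  where
  module P = Finite finP
  module Q = Finite finQ
  open Equivalence using () renaming (to to ⇒; from to ⇐)

  to : ∀ {y} → y ∈ List.map f P.elements → y ∈ Q.elements
  to y∈ with x , x∈ , refl ← ∈-map⁻ f y∈ = ⇐ (Q.enumerates _) (sound (⇒ (P.enumerates x) x∈))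

  from : ∀ {y} → y ∈ Q.elements → y ∈ List.map f P.elements
  from y∈ with x , px , refl ← complete (⇒ (Q.enumerates _) y∈) =
    ∈-map⁺ f (⇐ (P.enumerates x) px)

map-injective : ∀ {A B : Set} {f : A → B} → Injective _≡_ _≡_ f →
                ∀ {k} → Injective _≡_ _≡_ (Vec.map {n = k} f)
map-injective inj {x = []}    {[]}    _  = refl
map-injective inj {x = _ ∷ _} {_ ∷ _} eq with p , ps ← ∷-injective eq =
  cong₂ _∷_ (inj p) (map-injective inj ps)

-- By induction: passing from `z` to `suc z` adds `(z + 1) * 2`.
2∣z*[z+1] : ∀ z → 2 ∣ z * (z + 1)
2∣z*[z+1] zero    = divides-refl 0
2∣z*[z+1] (suc z) = subst (2 ∣_) (identity z) (∣m∣n⇒∣m+n (2∣z*[z+1] z) (n∣m*n (z + 1)))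
  where
  identity : ∀ z → z * (z + 1) + (z + 1) * 2 ≡ suc z * (suc z + 1)
  identity = solve-∀

odd : ℕ → ℕ
odd z = suc (2 * z)

odd² : ∀ z → odd z * odd z ≡ 8 * triangular z + 1
odd² z = begin
  odd z * odd z                ≡⟨ expand z ⟩
  -- Evenness makes the truncating division inside `triangular` exact, so doubling it recovers
  -- `z * (z + 1)`.
  4 * (z * (z + 1)) + 1        ≡⟨ cong (λ m → 4 * m + 1) (m/n*n≡m (2∣z*[z+1] z)) ⟨
  4 * (triangular z * 2) + 1   ≡⟨ regroup (triangular z) ⟩
  8 * triangular z + 1         ∎
  where
  expand : ∀ z → suc (2 * z) * suc (2 * z) ≡ 4 * (z * (z + 1)) + 1
  expand = solve-∀
  regroup : ∀ t → 4 * (t * 2) + 1 ≡ 8 * t + 1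
  regroup = solve-∀

oddℤ : ℕ → ℤ
oddℤ z = + odd z

oddℤ-injective : Injective _≡_ _≡_ oddℤ
oddℤ-injective = ℕ.*-cancelˡ-≡ _ _ 2 ∘ ℕ.suc-injective ∘ ℤ.+-injective

2∤oddℤ : ∀ z → ¬ (+ 2 ℤ.∣ oddℤ z)
2∤oddℤ z 2∣ with divides a eq ← ℤ.∣⇒∣ᵤ 2∣ =
  ℕ.even≢odd a z (trans (ℕ.*-comm 2 a) (sym eq))

-- Nonnegativity turns `y` into a natural `m`. Remainder 0 modulo 2 contradicts oddness, and
-- remainder 1 makes the quotient `m / 2` the preimage.
oddℤ-surjective : ∀ {y} → 0ℤ ℤ.≤ y → ¬ (+ 2 ℤ.∣ y) → ∃ λ z → y ≡ oddℤ z
oddℤ-surjective (+≤+ {n = m} _) 2∤m with m % 2 | m%n<n m 2 | m≡m%n+[m/n]*n m 2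
... | 0 | _ | eq = contradiction (ℤ.∣ᵤ⇒∣ (divides (m / 2) eq)) 2∤m
... | 1 | _ | eq = m / 2 , cong +_ (trans eq (cong suc (ℕ.*-comm (m / 2) 2)))
... | suc (suc _) | s≤s (s≤s ()) | _

map-oddℤ-surjective : ∀ {k} {y : Vec ℤ k} →
                      All (0ℤ ℤ.≤_) y → All (λ yᵢ → ¬ (+ 2 ℤ.∣ yᵢ)) y →
                      ∃ λ z → y ≡ Vec.map oddℤ z
map-oddℤ-surjective []       []       = [] , refl
map-oddℤ-surjective (p ∷ ps) (o ∷ os)
  with z , refl ← oddℤ-surjective p o | zs , refl ← map-oddℤ-surjective ps os = z ∷ zs , refl

weighted-odd² : ∀ c z → + c ℤ.* (oddℤ z ℤ.^ 2) ≡ + (8 * (c * triangular z) + c)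
weighted-odd² c z = begin
  -- The power unfolds to `oddℤ z ℤ.* (oddℤ z ℤ.* + 1)`; the trailing unit is removed first.
  + c ℤ.* (oddℤ z ℤ.^ 2)         ≡⟨ cong (λ i → + c ℤ.* (oddℤ z ℤ.* i)) (ℤ.*-identityʳ (oddℤ z)) ⟩
  + c ℤ.* (oddℤ z ℤ.* oddℤ z)    ≡⟨ cong (+ c ℤ.*_) (ℤ.pos-* (odd z) (odd z)) ⟨
  + c ℤ.* + (odd z * odd z)      ≡⟨ ℤ.pos-* c (odd z * odd z) ⟨
  + (c * (odd z * odd z))        ≡⟨ cong (λ m → + (c * m)) (odd² z) ⟩
  + (c * (8 * triangular z + 1)) ≡⟨ cong +_ (distribute c (triangular z)) ⟩
  + (8 * (c * triangular z) + c) ∎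
  where
  distribute : ∀ c t → c * (8 * t + 1) ≡ 8 * (c * t) + c
  distribute = solve-∀

-- The 1 in `odd²`, weighted by each coefficient, leaves one copy of that coefficient per
-- coordinate; together these copies form the shift `sum C`.
squareSum-oddℤ : ∀ {k} (C z : Vec ℕ k) →
                 squareSum C (Vec.map oddℤ z) ≡ + (8 * triangularSum C z + sum C)
squareSum-oddℤ []      []      = refl
squareSum-oddℤ (c ∷ C) (z ∷ zs) = begin
  squareSum (c ∷ C) (Vec.map oddℤ (z ∷ zs))
    -- The sum of two nonnegative integers `+ a` and `+ b` computes to `+ (a + b)`, so the rest is
    -- an identity in ℕ.
    ≡⟨ cong₂ ℤ._+_ (weighted-odd² c z) (squareSum-oddℤ C zs) ⟩
  + ((8 * (c * triangular z) + c) + (8 * triangularSum C zs + sum C))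
    ≡⟨ cong +_ (regroup (c * triangular z) c (triangularSum C zs) (sum C)) ⟩
  + (8 * triangularSum (c ∷ C) (z ∷ zs) + sum (c ∷ C)) ∎
  where
  regroup : ∀ t c s h → (8 * t + c) + (8 * s + h) ≡ 8 * (t + s) + (c + h)
  regroup = solve-∀

δ≡q : ∀ {k} (C : Vec ℕ k) (pos : Positive C) n → δ C pos n ≡ q C pos (8 * n + sum C)
δ≡q C pos n = #-bijection
  (triangularRep-finite C pos n) (oddSquareRep-finite C pos (8 * n + sum C))
  (Vec.map oddℤ) (map-injective oddℤ-injective) sound complete
  where
  sound : ∀ {z} → TriangularRep C n z → OddSquareRep C (8 * n + sum C) (Vec.map oddℤ z)
  -- Matching on `refl` replaces `n` by `triangularSum C z`.
  sound {z} refl = sym (squareSum-oddℤ C z)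
                 , All.map⁺ (All.universal (λ _ → +≤+ z≤n) z)
                 , All.map⁺ (All.universal 2∤oddℤ z)

  complete : ∀ {y} → OddSquareRep C (8 * n + sum C) y →
             ∃ λ z → TriangularRep C n z × y ≡ Vec.map oddℤ z
  complete (eq , y≥0 , 2∤y) with z , refl ← map-oddℤ-surjective y≥0 2∤y =
    -- Both sides now have the form 8 times a number plus `sum C`; cancelling the shift and then the
    -- factor 8 leaves `n ≡ triangularSum C z`.
    z , ℕ.*-cancelˡ-≡ _ _ 8 (ℕ.+-cancelʳ-≡ (sum C) _ _
          (ℤ.+-injective (trans eq (squareSum-oddℤ C z)))) , refl

sum-ones : ∀ k → sum (ones k) ≡ k
sum-ones zero    = refl
sum-ones (suc k) = cong suc (sum-ones k)

proposition1p6 : (k : ℕ) → 0 < k →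
    ((C : Vec ℕ k) (pos : Positive C) → Linked _≤_ C →
    (n : ℕ) → 0 < n →
    δ C pos n ≡ q C pos (8 * n + sum C))
    ×
    ((n : ℕ) → 0 < n → δ₁ k n ≡ q₁ k (8 * n + k))
proposition1p6 k _ =
    (λ C pos _ n _ → δ≡q C pos n)
  -- For variable `k`, `sum (ones k)` does not reduce to `k`, so the shift is transported along
  -- `sum-ones`.
  , (λ n _ → subst (λ h → δ₁ k n ≡ q₁ k (8 * n + h)) (sum-ones k)
               (δ≡q (ones k) (ones-positive k) n))
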